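{- When $p_1 < q_{\ell+1}$ (the largest open-shop job is larger than every flow-shop job), the three-machine proportionate mixed shop problem $M3 \mid prpt \mid C_{\max}$ admits an $O(n\log n)$-time $4/3$-approximation algorithm; that is, there is an algorithm which, on every instance with $p_1<q_{\ell+1}$, runs in time $O(n\log n)$ and outputs a feasible schedule of makespan at most $\frac43 C^*_{\max}$, where $C^*_{\max}$ is the minimum makespan of the instance.
   Context: Problem $M3 \mid prpt \mid C_{\max}$. There are three machines $M_1,M_2,M_3$ and a set $\mathcal{J}=\mathcal{F}\cup\mathcal{O}$ of $n$ jobs, with flow-shop jobs $\mathcal{F}=\{J_1,\dots,J_\ell\}$ and open-shop jobs $\mathcal{O}=\{J_{\ell+1},\dots,J_n\}$. Each $J_i\in\mathcal{F}$ must be processed non-preemptively on $M_1$, then $M_2$, then $M_3$, with processing time $p_i>0$ on each machine. Each $J_i\in\mathcal{O}$ must be processed non-preemptively on each of the three machines, in any machine order, with processing time $q_i>0$ on each machine. At every time a job is processed by at most one machine and a machine processes at most one job. A feasible schedule starts at time $0$ and its makespan is the maximum completion time of a job; the goal is to minimize the makespan, and the minimum is denoted $C^*_{\max}$. Jobs are indexed so that $p_1\ge p_2\ge\dots\ge p_\ell$ and $q_{\ell+1}\ge q_{\ell+2}\ge\dots\ge q_n$; here $1\le\ell<n$ so that $p_1$ and $q_{\ell+1}$ exist. As usual for such bounds, running time counts elementary arithmetic operations and comparisons on the processing times. -}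

module Defs where

open import Algebra.Bundles using (RawMonoid)
open import Algebra.Structures using (IsAbelianGroup)
open import Data.Bool.Base using (Bool)
open import Data.Fin.Base using (Fin)
open import Data.List.Base using (List; []; _∷_; _++_; map; allFin)
open import Data.Nat.Base as ℕ using (ℕ; suc)
open import Data.Product.Base using (Σ-syntax; ∃-syntax; _×_; _,_)
open import Data.Sum.Base using (_⊎_; inj₁; inj₂)
open import Data.Vec.Functional using (Vector)
open import Relation.Binary.Bundles using (DecTotalOrder)
open import Relation.Binary.Core using (Rel; _Preserves_⟶_)
open import Relation.Binary.PropositionalEquality.Core using (_≡_)
open import Relation.Binary.Structures using (IsDecTotalOrder)
open import Relation.Nullary.Decidable.Core using (does)
import Algebra.Definitions.RawMonoid as Multiples
import Data.List.Extrema as Extrema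
import Relation.Binary.Properties.DecTotalOrder as DecTotalOrderProperties

-- Time is any linearly ordered abelian group with decidable order. This covers
-- ℤ and ℚ and, classically, ℝ; nothing in the problem multiplies two times.

record OrderedGroup : Set₁ where
  infix  4 _≤_
  infixl 6 _+_
  infix  8 -_
  field
    Carrier         : Set
    _+_             : Carrier → Carrier → Carrier
    0#              : Carrier
    -_              : Carrier → Carrier
    _≤_             : Rel Carrier _
    isAbelianGroup  : IsAbelianGroup _≡_ _+_ 0# -_
    isDecTotalOrder : IsDecTotalOrder _≡_ _≤_
    +-monoʳ-≤       : ∀ x → (x +_) Preserves _≤_ ⟶ _≤_

  open IsDecTotalOrder isDecTotalOrder public using (_≤?_)

  decTotalOrder : DecTotalOrder _ _ _
  decTotalOrder = record { isDecTotalOrder = isDecTotalOrder }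

  +-rawMonoid : RawMonoid _ _
  +-rawMonoid = record { _≈_ = _≡_ ; _∙_ = _+_ ; ε = 0# }

  open DecTotalOrderProperties decTotalOrder public using (_<_)
  open Extrema (DecTotalOrder.totalOrder decTotalOrder) public using (max)
  open Multiples +-rawMonoid public renaming (_×_ to _·_) using ()

data Machine : Set where
  M₁ M₂ M₃ : Machine

machines : List Machine
machines = M₁ ∷ M₂ ∷ M₃ ∷ []

-- ℓ flow-shop jobs and k open-shop jobs, so n = ℓ + k.

Job : ℕ → ℕ → Set
Job ℓ k = Fin ℓ ⊎ Fin k

pattern flow i = inj₁ i
pattern open-shop o = inj₂ o

jobs : ∀ ℓ k → List (Job ℓ k)
jobs ℓ k = map inj₁ (allFin ℓ) ++ map inj₂ (allFin k)

-- The start time of each job on each machine; processing is non-preemptive, so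
-- the start times determine the schedule.

Schedule : Set → ℕ → ℕ → Set
Schedule T ℓ k = Job ℓ k → Machine → T

module _ (K : OrderedGroup) where
  open OrderedGroup K

  -- The jobs come in arbitrary order: sorting them, if an algorithm needs it,
  -- is part of its running time.

  record Instance : Set where
    field
      {ℓ k} : ℕ
      1≤ℓ   : 1 ℕ.≤ ℓ
      1≤k   : 1 ℕ.≤ k
      p     : Vector Carrier ℓ
      q     : Vector Carrier k
      p>0   : ∀ i → 0# < p i
      q>0   : ∀ o → 0# < q o

    n : ℕ
    n = ℓ ℕ.+ k

    processingTime : Job ℓ k → Carrier
    processingTime (flow i)      = p i
    processingTime (open-shop o) = q o

module _ {K : OrderedGroup} (I : Instance K) where
  open OrderedGroup K
  open Instance I

  -- i₁ and o₁ are the first jobs of their kinds in an ordering by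
  -- non-increasing processing time.

  LargestJobIsOpenShop : Set
  LargestJobIsOpenShop =
    Σ[ i₁ ∈ Fin ℓ ] Σ[ o₁ ∈ Fin k ]
      (∀ i → p i ≤ p i₁) × (∀ o → q o ≤ q o₁) × p i₁ < q o₁

  module _ (S : Schedule Carrier ℓ k) where

    end : Job ℓ k → Machine → Carrier
    end j m = S j m + processingTime j

    -- Processing intervals are half-open, so one operation may start at the
    -- moment another one ends.

    Processing : Carrier → Job ℓ k → Machine → Set
    Processing τ j m = S j m ≤ τ × τ < end j m

    record Feasible : Set where
      field
        startsFromZero   : ∀ j m → 0# ≤ S j m
        oneMachinePerJob : ∀ τ j {m m′} →
                           Processing τ j m → Processing τ j m′ → m ≡ m′
        oneJobPerMachine : ∀ τ m {j j′} →
                           Processing τ j m → Processing τ j′ m → j ≡ j′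
        M₁-before-M₂     : ∀ i → end (flow i) M₁ ≤ S (flow i) M₂
        M₂-before-M₃     : ∀ i → end (flow i) M₂ ≤ S (flow i) M₃

    -- The default 0# of max is harmless: in a feasible schedule every operation
    -- ends after time 0.

    completion : Job ℓ k → Carrier
    completion j = max 0# (map (end j) machines)

    makespan : Carrier
    makespan = max 0# (map completion (jobs ℓ k))

  IsMinimumMakespan : Carrier → Set
  IsMinimumMakespan C* =
    (∃[ S ] (Feasible S × makespan S ≡ C*)) ×
    (∀ S → Feasible S → C* ≤ makespan S)

-- An algebraic computation tree over T with leaves in A. Running time
-- counts the additions, subtractions and comparisons of times; each
-- constructor other than return performs one.

data Program (T A : Set) : Set where
  return : A → Program T A
  add    : T → T → (T → Program T A) → Program T A
  sub    : T → T → (T → Program T A) → Program T A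
  leq    : T → T → (Bool → Program T A) → Program T A

module _ (K : OrderedGroup) {A : Set} where
  open OrderedGroup K

  result : Program Carrier A → A
  result (return a)  = a
  result (add x y f) = result (f (x + y))
  result (sub x y f) = result (f (x + (- y)))
  result (leq x y f) = result (f (does (x ≤? y)))

  steps : Program Carrier A → ℕ
  steps (return _)  = 0
  steps (add x y f) = suc (steps (f (x + y)))
  steps (sub x y f) = suc (steps (f (x + (- y))))
  steps (leq x y f) = suc (steps (f (does (x ≤? y))))

-- Since T is abstract here, an algorithm can inspect the processing times only
-- through the counted operations.

Algorithm : Set₁
Algorithm = ∀ {T : Set} {ℓ k : ℕ} →
            Vector T ℓ → Vector T k → Program T (Schedule T ℓ k)

module _ (A : Algorithm) {K : OrderedGroup} (I : Instance K) where
  open OrderedGroup K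
  open Instance I

  output : Schedule Carrier ℓ k
  output = result K (A p q)

  runningTime : ℕ
  runningTime = steps K (A p q)

  -- makespan ≤ (4/3) C*, cleared of denominators.

  FourThirdsApproximate : Set
  FourThirdsApproximate =
    Feasible I output ×
    (∀ C* → IsMinimumMakespan I C* → 3 · makespan I output ≤ 4 · C*)

{-# OPTIONS --safe #-}
module Submission where

-- Let a be the length of a longest open-shop job J, and T the total length of all
-- jobs, so that T ≤ C* (load of one machine) and 3a ≤ C* (the operations of J).
-- Route every job other than J through M₁, M₂, M₃ in one fixed order, without
-- idle time, starting at 0 on M₁, at a on M₂ and at 2a on M₃. Since no job is
-- longer than a, a job leaves each machine before it starts on the next one. The
-- job J fits before the others on M₂ (from 0) and on M₃ (from a), and comes last
-- on M₁, from the later of 2a and T − a. The makespan is at most the larger of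
-- 3a and T + a, hence at most C* + a ≤ (4/3) C*. No sorting is needed: finding J
-- and the prefix sums take linear time.

open import Algebra.Bundles using (AbelianGroup)
open import Data.Bool.Base using (if_then_else_)
open import Data.Fin.Base using (Fin; zero; suc)
open import Data.Fin.Patterns using (0F; 1F; 2F)
open import Data.Fin.Permutation using (transpose)
open import Data.Fin.Properties using (+↔⊎; 0≢1+n; suc-injective)
open import Data.List.Base using (map; allFin)
open import Data.List.Membership.Propositional using (_∈_)
open import Data.List.Membership.Propositional.Properties using (∈-++⁺ˡ; ∈-++⁺ʳ; ∈-map⁺; ∈-allFin)
import Data.List.Relation.Unary.All as All
import Data.List.Relation.Unary.All.Properties as All
open import Data.List.Relation.Unary.Any using (here; there)
open import Data.Nat.Base using (ℕ; zero; suc; _*_; _≤_; >-nonZero)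
  renaming (_+_ to _ℕ+_)
open import Data.Nat.Logarithm using (⌈log₂_⌉; ⌈log₂⌉-mono-≤; ⌈log₂2^n⌉≡n)
open import Data.Nat.Solver using (module +-*-Solver)
open import Data.Product.Base using (Σ-syntax; ∃-syntax; _×_; _,_; proj₁; proj₂)
open import Data.Sum.Algebra using (⊎-comm)
open import Data.Sum.Base as Sum using (_⊎_; inj₁; inj₂; [_,_])
open import Data.Sum.Function.Propositional using (_⊎-↔_)
open import Data.Vec.Functional using (Vector; []; _∷_; head; tail)
open import Function.Base using (_∘_)
open import Function.Bundles using (_↔_; Inverse; Injection)
open import Function.Construct.Composition using (_↔-∘_)
open import Function.Construct.Identity using (↔-id)
open import Function.Properties.Inverse using (↔⇒↣; ↔-sym)
open import Relation.Binary.Bundles using (DecTotalOrder)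
open import Relation.Binary.Definitions using (Symmetric)
open import Relation.Binary.PropositionalEquality
  using (_≡_; _≢_; refl; sym; trans; cong; subst; subst₂)
open import Relation.Nullary using (¬_; yes; no; contradiction)
open import Relation.Nullary.Decidable.Core using (does)
import Algebra.Properties.CommutativeMonoid.Mult as Mult
import Algebra.Properties.Group as GroupProperties
import Data.List.Extrema as Extrema
import Data.Nat.Properties as ℕ
import Relation.Binary.Properties.DecTotalOrder as DecTotalOrderProperties
import Relation.Binary.Reasoning.PartialOrder as PartialOrderReasoning
open import Defs

-- The algorithm.

-- Continuation-passing style puts every counted operation directly in front of the rest of the
-- program.
argmax : ∀ {T A k} → Vector T (suc k) → (Fin (suc k) → Program T A) → Program T A
argmax {k = zero}  v κ = κ zero
argmax {k = suc k} v κ = argmax (tail v) λ i →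
  leq (head v) (v (suc i)) λ b → κ (if b then suc i else zero)

prefixSums : ∀ {T A n} → T → Vector T n → (Vector T n → T → Program T A) → Program T A
prefixSums {n = zero}  t w κ = κ [] t
prefixSums {n = suc n} t w κ = add t (head w) λ u → prefixSums u (tail w) λ s → κ (t ∷ s)

-- Position zero is the open-shop job o.
layout : ∀ {ℓ k} → Fin (suc k) → Fin (suc k ℕ+ ℓ) ↔ Job ℓ (suc k)
layout o = ⊎-comm _ _ ↔-∘ ((transpose zero o ⊎-↔ ↔-id _) ↔-∘ +↔⊎)

byMachine : ∀ {A : Set} → A → A → A → Machine → A
byMachine x₁ x₂ x₃ M₁ = x₁
byMachine x₁ x₂ x₃ M₂ = x₂
byMachine x₁ x₂ x₃ M₃ = x₃

module _ {T : Set} {ℓ k : ℕ} (p : Vector T ℓ) (q : Vector T (suc k)) (o : Fin (suc k)) where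
  open Inverse (layout {ℓ} o)

  lengths : Vector T (suc k ℕ+ ℓ)
  lengths = [ p , q ] ∘ to

  -- On `M₁` position zero starts at the later of `r`, when the other jobs have left `M₁`, and `b`,
  -- when its own operation on `M₃` ends.
  combine : Vector T (k ℕ+ ℓ) → T → Vector T (suc k ℕ+ ℓ) → Vector T (suc k ℕ+ ℓ) →
            Program T (Schedule T ℓ (suc k))
  combine s₁ r s₂ s₃ =
    add (head lengths) (head lengths) λ b →
    leq r b λ r≤b →
    return λ j m → byMachine ((if r≤b then b else r) ∷ s₁) s₂ s₃ m (from j)

  timetable : Program T (Schedule T ℓ (suc k))
  timetable =
    sub (head lengths) (head lengths) λ t →  -- t is 0#, which T does not provide
    -- On `M₁` position zero is held back for `combine` to place last. On `M₂` and `M₃` it leads the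
    -- sequence, which starts there at 0 and at its own length.
    prefixSums t (tail lengths) λ s₁ r →
    prefixSums t lengths λ s₂ _ →
    prefixSums (head lengths) lengths λ s₃ _ →
    combine s₁ r s₂ s₃

algorithm : Algorithm
-- Instances have an open-shop job, so the schedule for k = 0 is never used.
algorithm {k = zero}  p q = return λ { (flow i) _ → p i }
algorithm {k = suc k} p q = argmax q (timetable p q)

-- Enumerations of machines and jobs.

≡⊎-pairwise : ∀ {R : Machine → Machine → Set} → Symmetric R →
              R M₁ M₂ → R M₂ M₃ → R M₁ M₃ → ∀ m m′ → m ≡ m′ ⊎ R m m′
≡⊎-pairwise s r₁₂ r₂₃ r₁₃ M₁ M₁ = inj₁ refl
≡⊎-pairwise s r₁₂ r₂₃ r₁₃ M₁ M₂ = inj₂ r₁₂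
≡⊎-pairwise s r₁₂ r₂₃ r₁₃ M₁ M₃ = inj₂ r₁₃
≡⊎-pairwise s r₁₂ r₂₃ r₁₃ M₂ M₁ = inj₂ (s r₁₂)
≡⊎-pairwise s r₁₂ r₂₃ r₁₃ M₂ M₂ = inj₁ refl
≡⊎-pairwise s r₁₂ r₂₃ r₁₃ M₂ M₃ = inj₂ r₂₃
≡⊎-pairwise s r₁₂ r₂₃ r₁₃ M₃ M₁ = inj₂ (s r₁₃)
≡⊎-pairwise s r₁₂ r₂₃ r₁₃ M₃ M₂ = inj₂ (s r₂₃)
≡⊎-pairwise s r₁₂ r₂₃ r₁₃ M₃ M₃ = inj₁ refl

-- Indexing by `Fin 3` turns the operations of one job into a vector of intervals, to which
-- `disjoint⇒sum≤` applies.
machine : Fin 3 → Machine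
machine = M₁ ∷ M₂ ∷ M₃ ∷ []

machine-injective : ∀ {x y} → machine x ≡ machine y → x ≡ y
machine-injective {x} {y} eq = trans (sym (inverse x)) (trans (cong (byMachine 0F 1F 2F) eq) (inverse y))
  where
  inverse : ∀ x → byMachine 0F 1F 2F (machine x) ≡ x
  inverse 0F = refl
  inverse 1F = refl
  inverse 2F = refl

∈-machines : ∀ m → m ∈ machines
∈-machines M₁ = here refl
∈-machines M₂ = there (here refl)
∈-machines M₃ = there (there (here refl))

∈-jobs : ∀ {ℓ k} (j : Job ℓ k) → j ∈ jobs ℓ k
∈-jobs (flow i)          = ∈-++⁺ˡ (∈-map⁺ inj₁ (∈-allFin i))
∈-jobs {ℓ} (open-shop o) = ∈-++⁺ʳ (map inj₁ (allFin ℓ)) (∈-map⁺ inj₂ (∈-allFin o))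

module _ (K : OrderedGroup) where
  open OrderedGroup K renaming (_≤_ to _⊑_; _+_ to _⊕_)
  open DecTotalOrder decTotalOrder using (total; poset) renaming (refl to ⊑-refl; trans to ⊑-trans)
  open PartialOrderReasoning poset using (begin_; step-≤; step-≡-⟩; _∎)
  open Extrema (DecTotalOrder.totalOrder decTotalOrder) using (max≤v⁺; xs≤max; ⊥≤max)
  open DecTotalOrderProperties decTotalOrder using (≰⇒>; <⇒≱; ≰⇒≥)
  open import Algebra.Definitions.RawMonoid +-rawMonoid using (sum)

  -- Arithmetic in a linearly ordered abelian group.

  abelianGroup : AbelianGroup _ _
  abelianGroup = record { isAbelianGroup = isAbelianGroup }

  open AbelianGroup abelianGroup
    using (group; assoc; comm; identityˡ; identityʳ; commutativeMonoid)
    renaming (inverseʳ to +-inverseʳ)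
  open GroupProperties group using (identityʳ-unique)
  open Mult commutativeMonoid using (×-distrib-+)

  ⊑-respˡ-≡ : ∀ {x y z} → x ≡ y → x ⊑ z → y ⊑ z
  ⊑-respˡ-≡ refl x≤z = x≤z

  ⊑-respʳ-≡ : ∀ {x y z} → y ≡ z → x ⊑ y → x ⊑ z
  ⊑-respʳ-≡ refl x≤y = x≤y

  +-monoˡ-≤ : ∀ z {x y} → x ⊑ y → x ⊕ z ⊑ y ⊕ z
  +-monoˡ-≤ z {x} {y} x≤y = subst₂ _⊑_ (comm z x) (comm z y) (+-monoʳ-≤ z x≤y)

  +-mono-≤ : ∀ {x y u v} → x ⊑ y → u ⊑ v → x ⊕ u ⊑ y ⊕ v
  +-mono-≤ {y = y} {u} x≤y u≤v = ⊑-trans (+-monoˡ-≤ u x≤y) (+-monoʳ-≤ y u≤v)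

  x≤x+y : ∀ {x y} → 0# ⊑ y → x ⊑ x ⊕ y
  x≤x+y {x} 0≤y = ⊑-respˡ-≡ (identityʳ x) (+-monoʳ-≤ x 0≤y)

  x<x+y : ∀ {x y} → 0# < y → x < x ⊕ y
  x<x+y (0≤y , 0≢y) = x≤x+y 0≤y , λ x≡x+y → 0≢y (sym (identityʳ-unique _ _ (sym x≡x+y)))

  +-swapʳ : ∀ x y z → (x ⊕ y) ⊕ z ≡ (x ⊕ z) ⊕ y
  +-swapʳ x y z = trans (assoc x y z) (trans (cong (x ⊕_) (comm y z)) (sym (assoc x z y)))

  ·-monoʳ-≤ : ∀ n {x y} → x ⊑ y → n · x ⊑ n · y
  ·-monoʳ-≤ zero    x≤y = ⊑-refl
  ·-monoʳ-≤ (suc n) x≤y = +-mono-≤ x≤y (·-monoʳ-≤ n x≤y)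

  sum≥0 : ∀ {n} (w : Vector Carrier n) → (∀ i → 0# ⊑ w i) → 0# ⊑ sum w
  sum≥0 {zero}  w w≥0 = ⊑-refl
  sum≥0 {suc n} w w≥0 = ⊑-trans (w≥0 zero) (x≤x+y (sum≥0 (tail w) (w≥0 ∘ suc)))

  -- The same conditional as in `combine`, so that evaluating the program yields this maximum by
  -- computation alone.
  infixl 6 _⊔_
  _⊔_ : Carrier → Carrier → Carrier
  x ⊔ y = if does (x ≤? y) then y else x

  x≤x⊔y : ∀ x y → x ⊑ x ⊔ y
  x≤x⊔y x y with x ≤? y
  ... | yes x≤y = x≤y
  ... | no  _   = ⊑-refl

  y≤x⊔y : ∀ x y → y ⊑ x ⊔ y
  y≤x⊔y x y with x ≤? y
  ... | yes _   = ⊑-refl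
  ... | no  x≰y = ≰⇒≥ x≰y

  ⊔-elim : ∀ (P : Carrier → Set) {x y} → P x → P y → P (x ⊔ y)
  ⊔-elim P {x} {y} px py with x ≤? y
  ... | yes _ = py
  ... | no  _ = px

  -- Separated intervals and their total length.

  During : Carrier → Carrier → Carrier → Set
  During τ x d = x ⊑ τ × τ < x ⊕ d

  Separate : Carrier → Carrier → Carrier → Carrier → Set
  Separate x d y e = x ⊕ d ⊑ y ⊎ y ⊕ e ⊑ x

  separate⇒¬both : ∀ {x d y e τ} → Separate x d y e → During τ x d → ¬ During τ y e
  separate⇒¬both (inj₁ x+d≤y) (_ , τ<x+d) (y≤τ , _) = <⇒≱ τ<x+d (⊑-trans x+d≤y y≤τ)
  separate⇒¬both (inj₂ y+e≤x) (x≤τ , _) (_ , τ<y+e) = <⇒≱ τ<y+e (⊑-trans y+e≤x x≤τ)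

  -- If both inequalities fail, the later of the two starts lies in both intervals; positive length
  -- puts it inside its own half-open interval.
  ¬both⇒separate : ∀ {x d y e} → 0# < d → 0# < e →
                   (∀ τ → During τ x d → ¬ During τ y e) → Separate x d y e
  ¬both⇒separate {x} {d} {y} {e} d>0 e>0 ¬both with (x ⊕ d) ≤? y | (y ⊕ e) ≤? x
  ... | yes x+d≤y | _         = inj₁ x+d≤y
  ... | no _      | yes y+e≤x = inj₂ y+e≤x
  ... | no x+d≰y  | no y+e≰x with total x y
  ...   | inj₁ x≤y = contradiction (⊑-refl , x<x+y e>0) (¬both y (x≤y , ≰⇒> x+d≰y))
  ...   | inj₂ y≤x = contradiction (y≤x , ≰⇒> y+e≰x) (¬both x (⊑-refl , x<x+y d>0))

  -- Induction on the number of intervals: the intervals to the left of the first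
  -- one are moved right by its length, which frees [lo , lo + w₀).
  disjoint⇒sum≤ : ∀ {n lo hi} (s w : Vector Carrier n) →
                  (∀ {i j} → i ≢ j → Separate (s i) (w i) (s j) (w j)) →
                  (∀ i → 0# ⊑ w i) → (∀ i → lo ⊑ s i) → (∀ i → s i ⊕ w i ⊑ hi) →
                  lo ⊑ hi → lo ⊕ sum w ⊑ hi
  disjoint⇒sum≤ {zero} {lo} {hi} s w sep w≥0 ≥lo ≤hi lo≤hi = ⊑-respˡ-≡ (sym (identityʳ lo)) lo≤hi
  disjoint⇒sum≤ {suc n} {lo} {hi} s w sep w≥0 ≥lo ≤hi lo≤hi =
    ⊑-respˡ-≡ (assoc lo d (sum (tail w)))
      (disjoint⇒sum≤ s′ (tail w) sep′ (w≥0 ∘ suc) ≥lo′ ≤hi′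
        (⊑-trans (+-monoˡ-≤ d (≥lo zero)) (≤hi zero)))
    where
    d = head w

    Side : Fin n → Set
    Side i = Separate (head s) d (s (suc i)) (w (suc i))

    side : ∀ i → Side i
    side i = sep 0≢1+n

    shift : ∀ i → Side i → Carrier
    shift i (inj₁ _) = s (suc i)
    shift i (inj₂ _) = s (suc i) ⊕ d

    s′ : Vector Carrier n
    s′ i = shift i (side i)

    shift-end : ∀ i → s (suc i) ⊕ w (suc i) ⊑ head s → (s (suc i) ⊕ d) ⊕ w (suc i) ⊑ head s ⊕ d
    shift-end i before = ⊑-respˡ-≡ (+-swapʳ _ _ _) (+-monoˡ-≤ d before)

    ≥lo′ : ∀ i → lo ⊕ d ⊑ s′ i
    ≥lo′ i with side i
    ... | inj₁ after  = ⊑-trans (+-monoˡ-≤ d (≥lo zero)) after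
    ... | inj₂ before = +-monoˡ-≤ d (≥lo (suc i))

    ≤hi′ : ∀ i → s′ i ⊕ w (suc i) ⊑ hi
    ≤hi′ i with side i
    ... | inj₁ after  = ≤hi (suc i)
    ... | inj₂ before = ⊑-trans (shift-end i before) (≤hi zero)

    sep′ : ∀ {i j} → i ≢ j → Separate (s′ i) (w (suc i)) (s′ j) (w (suc j))
    sep′ {i} {j} i≢j with side i | side j | sep {suc i} {suc j} (i≢j ∘ suc-injective)
    ... | inj₁ _ | inj₁ _ | i∥j      = i∥j
    -- Only `j` is moved. It then ends by the end of the first interval, and `i` starts no earlier
    -- than that.
    ... | inj₁ a | inj₂ b | _        = inj₂ (⊑-trans (shift-end j b) a)
    ... | inj₂ b | inj₁ a | _        = inj₁ (⊑-trans (shift-end i b) a)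
    ... | inj₂ _ | inj₂ _ | inj₁ i<j = inj₁ (⊑-respˡ-≡ (+-swapʳ _ _ _) (+-monoˡ-≤ d i<j))
    ... | inj₂ _ | inj₂ _ | inj₂ j<i = inj₂ (⊑-respˡ-≡ (+-swapʳ _ _ _) (+-monoˡ-≤ d j<i))

  -- Jobs processed back to back.

  starts : ∀ {n} → Carrier → Vector Carrier n → Vector Carrier n
  starts {zero}  t w = []
  starts {suc n} t w = t ∷ starts (t ⊕ head w) (tail w)

  starts-≥ : ∀ {n} t (w : Vector Carrier n) → (∀ i → 0# ⊑ w i) → ∀ i → t ⊑ starts t w i
  starts-≥ t w w≥0 zero    = ⊑-refl
  starts-≥ t w w≥0 (suc i) = ⊑-trans (x≤x+y (w≥0 zero)) (starts-≥ _ (tail w) (w≥0 ∘ suc) i)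

  starts-end : ∀ {n} t (w : Vector Carrier n) → (∀ i → 0# ⊑ w i) → ∀ i →
               starts t w i ⊕ w i ⊑ t ⊕ sum w
  starts-end t w w≥0 zero    = +-monoʳ-≤ t (x≤x+y (sum≥0 (tail w) (w≥0 ∘ suc)))
  starts-end t w w≥0 (suc i) =
    ⊑-respʳ-≡ (assoc t (head w) (sum (tail w))) (starts-end _ (tail w) (w≥0 ∘ suc) i)

  starts-separate : ∀ {n} t (w : Vector Carrier n) → (∀ i → 0# ⊑ w i) → ∀ i j →
                    i ≡ j ⊎ Separate (starts t w i) (w i) (starts t w j) (w j)
  starts-separate t w w≥0 zero    zero    = inj₁ refl
  starts-separate t w w≥0 zero    (suc j) = inj₂ (inj₁ (starts-≥ _ (tail w) (w≥0 ∘ suc) j))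
  starts-separate t w w≥0 (suc i) zero    = inj₂ (inj₂ (starts-≥ _ (tail w) (w≥0 ∘ suc) i))
  starts-separate t w w≥0 (suc i) (suc j) =
    Sum.map₁ (cong suc) (starts-separate _ (tail w) (w≥0 ∘ suc) i j)

  -- Both sequences advance by the same lengths, so the lag between them stays that of `y` behind
  -- `x`, and every length fits into it.
  starts-delay : ∀ {n x y} (w : Vector Carrier n) → (∀ i → x ⊕ w i ⊑ y) → ∀ i →
                 starts x w i ⊕ w i ⊑ starts y w i
  starts-delay w delay zero    = delay zero
  starts-delay w delay (suc i) = starts-delay (tail w)
    (λ j → ⊑-respˡ-≡ (+-swapʳ _ _ _) (+-monoˡ-≤ (head w) (delay (suc j)))) i

  -- The origin `t` is a parameter because the program computes it as a difference, which equals
  -- `0#` only propositionally.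
  machineStarts : ∀ {m} → Carrier → Vector Carrier (suc m) → Machine → Vector Carrier (suc m)
  machineStarts t w = byMachine
    ((t ⊕ sum (tail w) ⊔ (head w ⊕ head w)) ∷ starts t (tail w))
    (starts t w)
    (starts (head w) w)

  -- Evaluation and cost of programs.

  module _ {A : Set} where

    -- P becomes Q after c counted operations.
    infix 4 _↠[_]_
    record _↠[_]_ (P : Program Carrier A) (c : ℕ) (Q : Program Carrier A) : Set where
      constructor _,_
      field
        result≡ : result K P ≡ result K Q
        steps≡  : steps K P ≡ c ℕ+ steps K Q

    ↠-cost : ∀ {P Q c d} → c ≡ d → P ↠[ c ] Q → P ↠[ d ] Q
    ↠-cost refl run = run

    ↠-trans : ∀ {P Q R c d} → P ↠[ c ] Q → Q ↠[ d ] R → P ↠[ c ℕ+ d ] R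
    ↠-trans {R = R} {c} {d} (r₁ , s₁) (r₂ , s₂) =
      trans r₁ r₂ , trans s₁ (trans (cong (c ℕ+_) s₂) (sym (ℕ.+-assoc c d (steps K R))))

    -- The program accumulates from the left while `sum` nests to the right; associativity and the
    -- identity law reconcile the two totals.
    prefixSums-↠ : ∀ {n} t (w : Vector Carrier n) (κ : Vector Carrier n → Carrier → Program Carrier A) →
                   prefixSums t w κ ↠[ n ] κ (starts t w) (t ⊕ sum w)
    prefixSums-↠ {zero}  t w κ =
      subst (λ e → κ [] t ↠[ 0 ] κ [] e) (sym (identityʳ t)) (refl , refl)
    prefixSums-↠ {suc n} t w κ =
      ↠-trans {c = 1} (refl , refl)
        (subst (λ e → prefixSums (t ⊕ head w) (tail w) (λ s → κ (t ∷ s)) ↠[ n ] κ (starts t w) e)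
          (assoc t (head w) (sum (tail w)))
          (prefixSums-↠ (t ⊕ head w) (tail w) λ s → κ (t ∷ s)))

    argmax-↠ : ∀ {k} (v : Vector Carrier (suc k)) (κ : Fin (suc k) → Program Carrier A) →
               ∃[ i ] (∀ j → v j ⊑ v i) × argmax v κ ↠[ k ] κ i
    argmax-↠ {zero}  v κ = zero , (λ { zero → ⊑-refl }) , refl , refl
    argmax-↠ {suc k} v κ
      with argmax-↠ (tail v) (λ i → leq (head v) (v (suc i)) λ b → κ (if b then suc i else zero))
    -- Abstracting the comparison together with the extended run lets the conditional at its end
    -- reduce in each branch.
    ... | i , max , run with head v ≤? v (suc i) | ↠-trans {d = 1} run (refl , refl)
    ... | yes v₀≤vᵢ | run′ = suc i , (λ { zero → v₀≤vᵢ ; (suc j) → max j }) ,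
                             ↠-cost (ℕ.+-comm k 1) run′
    ... | no  v₀≰vᵢ | run′ = zero , (λ { zero → ⊑-refl ; (suc j) → ⊑-trans (max j) (≰⇒≥ v₀≰vᵢ) }) ,
                             ↠-cost (ℕ.+-comm k 1) run′

  -- Lower bounds on the makespan.

  module _ (I : Instance K) where
    open Instance I

    processingTime>0 : ∀ j → 0# < processingTime j
    processingTime>0 (flow i)      = p>0 i
    processingTime>0 (open-shop o) = q>0 o

    module _ (S : Schedule Carrier ℓ k) where

      end≤makespan : ∀ j m → end I S j m ⊑ makespan I S
      end≤makespan j m =
        ⊑-trans (All.lookup (xs≤max 0# (map (end I S j) machines)) (∈-map⁺ (end I S j) (∈-machines m)))
                (All.lookup (xs≤max 0# (map (completion I S) (jobs ℓ k))) (∈-map⁺ (completion I S) (∈-jobs j)))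

      makespan≤ : ∀ {b} → 0# ⊑ b → (∀ j m → end I S j m ⊑ b) → makespan I S ⊑ b
      makespan≤ {b} 0≤b end≤b =
        max≤ (completion I S) (jobs ℓ k) λ j → max≤ (end I S j) machines (end≤b j)
        where
        max≤ : ∀ {A : Set} (f : A → Carrier) xs → (∀ x → f x ⊑ b) → max 0# (map f xs) ⊑ b
        max≤ f xs f≤b = max≤v⁺ 0≤b (All.map⁺ (All.universal f≤b xs))

      module _ (feasible : Feasible I S) where
        open Feasible feasible

        -- The operations on `M₁` are disjoint intervals between 0 and the makespan. Numbering the
        -- jobs by `position` makes the sum match the vector that the algorithm lays out.
        load≤makespan : ∀ {m} (position : Fin m ↔ Job ℓ k) (w : Vector Carrier m) →
                        (∀ x → w x ≡ processingTime (Inverse.to position x)) →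
                        sum w ⊑ makespan I S
        load≤makespan position w w≡ =
          ⊑-respˡ-≡ (identityˡ _) (disjoint⇒sum≤ (λ x → S (to x) M₁) w separate
            (λ x → proj₁ (w>0 x)) (λ x → startsFromZero (to x) M₁)
            (λ x → subst (λ d → S (to x) M₁ ⊕ d ⊑ _) (sym (w≡ x)) (end≤makespan (to x) M₁))
            (⊥≤max 0# (map (completion I S) (jobs ℓ k))))
          where
          open Inverse position

          w>0 : ∀ x → 0# < w x
          w>0 x = subst (0# <_) (sym (w≡ x)) (processingTime>0 (to x))

          separate : ∀ {x y} → x ≢ y → Separate (S (to x) M₁) (w x) (S (to y) M₁) (w y)
          separate {x} {y} x≢y = ¬both⇒separate (w>0 x) (w>0 y) λ τ at-x at-y →
            x≢y (Injection.injective (↔⇒↣ position) (oneJobPerMachine τ M₁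
              (subst (During τ _) (w≡ x) at-x) (subst (During τ _) (w≡ y) at-y)))

        -- The three operations of a job are disjoint in time, and the sum of the constant vector of
        -- length 3 unfolds to this multiple.
        3·processingTime≤makespan : ∀ j → 3 · processingTime j ⊑ makespan I S
        3·processingTime≤makespan j =
          ⊑-respˡ-≡ (identityˡ _) (disjoint⇒sum≤ (S j ∘ machine) (λ _ → processingTime j)
            (λ x≢y → ¬both⇒separate (processingTime>0 j) (processingTime>0 j) λ τ at-x at-y →
              x≢y (machine-injective (oneMachinePerJob τ j at-x at-y)))
            (λ _ → proj₁ (processingTime>0 j)) (startsFromZero j ∘ machine) (end≤makespan j ∘ machine)
            (⊥≤max 0# (map (completion I S) (jobs ℓ k))))

    -- A record and not a pair: conversion then compares the schedules themselves
    -- instead of the unfolded makespans, which is prohibitively slow.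
    record Approximates (S : Schedule Carrier ℓ k) : Set where
      constructor _,_
      field
        feasible : Feasible I S
        ratio    : ∀ c → IsMinimumMakespan I c → 3 · makespan I S ⊑ 4 · c

    approximates⇒fourThirds : ∀ (A : Algorithm) → Approximates (output A I) → FourThirdsApproximate A I
    approximates⇒fourThirds A (feasible , ratio) = feasible , ratio

    -- Feasibility and ratio of the constructed schedule.

    module _ {m} (position : Fin (suc m) ↔ Job ℓ k) (w : Vector Carrier (suc m))
             (w≡ : ∀ x → w x ≡ processingTime (Inverse.to position x))
             (o : Fin k) (first : Inverse.to position zero ≡ open-shop o)
             (longest : ∀ x → w x ⊑ w zero) where
      open Inverse position

      a r : Carrier
      a = head w
      r = 0# ⊕ sum (tail w)

      start : Machine → Vector Carrier (suc m)
      start = machineStarts 0# w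

      schedule : Schedule Carrier ℓ k
      schedule j M = start M (from j)

      w≥0 : ∀ x → 0# ⊑ w x
      w≥0 x = ⊑-respʳ-≡ (sym (w≡ x)) (proj₁ (processingTime>0 (to x)))

      processingTime≡w : ∀ j → processingTime j ≡ w (from j)
      processingTime≡w j = sym (trans (w≡ (from j)) (cong processingTime (strictlyInverseˡ j)))

      start≥0 : ∀ M x → 0# ⊑ start M x
      start≥0 M₁ zero    = ⊑-trans (⊑-trans (w≥0 zero) (x≤x+y (w≥0 zero))) (y≤x⊔y r (a ⊕ a))
      start≥0 M₁ (suc x) = starts-≥ 0# (tail w) (w≥0 ∘ suc) x
      start≥0 M₂ x       = starts-≥ 0# w w≥0 x
      start≥0 M₃ x       = ⊑-trans (w≥0 zero) (starts-≥ a w w≥0 x)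

      start-separate : ∀ M x y → x ≡ y ⊎ Separate (start M x) (w x) (start M y) (w y)
      start-separate M₁ zero    zero    = inj₁ refl
      start-separate M₁ zero    (suc y) =
        inj₂ (inj₂ (⊑-trans (starts-end 0# (tail w) (w≥0 ∘ suc) y) (x≤x⊔y r (a ⊕ a))))
      start-separate M₁ (suc x) zero    =
        inj₂ (inj₁ (⊑-trans (starts-end 0# (tail w) (w≥0 ∘ suc) x) (x≤x⊔y r (a ⊕ a))))
      start-separate M₁ (suc x) (suc y) =
        Sum.map₁ (cong suc) (starts-separate 0# (tail w) (w≥0 ∘ suc) x y)
      start-separate M₂ x y = starts-separate 0# w w≥0 x y
      start-separate M₃ x y = starts-separate a w w≥0 x y

      -- On `M₂` position zero goes first and delays the other jobs by `a`, which is at least the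
      -- length of each.
      start-M₁-M₂ : ∀ x → start M₁ (suc x) ⊕ w (suc x) ⊑ start M₂ (suc x)
      start-M₁-M₂ = starts-delay (tail w) λ x → +-monoʳ-≤ 0# (longest (suc x))

      start-M₂-M₃ : ∀ x → start M₂ x ⊕ w x ⊑ start M₃ x
      start-M₂-M₃ = starts-delay w λ x → ⊑-respˡ-≡ (sym (identityˡ (w x))) (longest x)

      -- Position zero visits `M₂`, `M₃`, `M₁` in this order; the term `a ⊕ a` in the maximum makes
      -- it wait for its end on `M₃`.
      start-M₃-M₁ : start M₃ zero ⊕ a ⊑ start M₁ zero
      start-M₃-M₁ = y≤x⊔y r (a ⊕ a)

      precede-trans : ∀ {s t u} x → s ⊕ w x ⊑ t → t ⊕ w x ⊑ u → s ⊕ w x ⊑ u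
      precede-trans x s≤t t≤u = ⊑-trans s≤t (⊑-trans (x≤x+y (w≥0 x)) t≤u)

      machines-separate : ∀ x M M′ → M ≡ M′ ⊎ Separate (start M x) (w x) (start M′ x) (w x)
      machines-separate zero = ≡⊎-pairwise Sum.swap
        (inj₂ (precede-trans zero (start-M₂-M₃ zero) start-M₃-M₁))
        (inj₁ (start-M₂-M₃ zero))
        (inj₂ start-M₃-M₁)
      machines-separate (suc x) = ≡⊎-pairwise Sum.swap
        (inj₁ (start-M₁-M₂ x))
        (inj₁ (start-M₂-M₃ (suc x)))
        (inj₁ (precede-trans (suc x) (start-M₁-M₂ x) (start-M₂-M₃ (suc x))))

      during : ∀ τ j M → Processing I schedule τ j M → During τ (start M (from j)) (w (from j))
      during τ j M = subst (During τ _) (processingTime≡w j)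

      -- Position zero, which breaks the flow-shop route, holds an open-shop job by `first`.
      from-flow : ∀ i → ∃[ x ] from (flow i) ≡ suc x
      from-flow i with from (flow i) in eq
      ... | suc x = x , refl
      ... | zero  with () ← trans (sym (strictlyInverseˡ (flow i))) (trans (cong to eq) first)

      schedule-feasible : Feasible I schedule
      schedule-feasible = record
        { startsFromZero   = λ j M → start≥0 M (from j)
        ; oneMachinePerJob = λ τ j {M} {M′} at-M at-M′ →
            [ (λ M≡M′ → M≡M′)
            , (λ sep → contradiction (during τ j M′ at-M′) (separate⇒¬both sep (during τ j M at-M)))
            ] (machines-separate (from j) M M′)
        ; oneJobPerMachine = λ τ M {j} {j′} at-j at-j′ →
            [ Injection.injective (↔⇒↣ (↔-sym position))
            , (λ sep → contradiction (during τ j′ M at-j′) (separate⇒¬both sep (during τ j M at-j)))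
            ] (start-separate M (from j) (from j′))
        ; M₁-before-M₂ = M₁-before-M₂
        ; M₂-before-M₃ = λ i → subst (λ d → start M₂ (from (flow i)) ⊕ d ⊑ start M₃ (from (flow i)))
            (sym (processingTime≡w (flow i))) (start-M₂-M₃ (from (flow i)))
        }
        where
        M₁-before-M₂ : ∀ i → end I schedule (flow i) M₁ ⊑ schedule (flow i) M₂
        M₁-before-M₂ i rewrite processingTime≡w (flow i) with from-flow i
        ... | x , eq rewrite eq = start-M₁-M₂ x

      -- The load bounds the sequences, which start at most `a` late. Position zero starts on `M₁`
      -- at `r` or `a ⊕ a`, both at most `c`, and runs for `a`.
      start-end≤ : ∀ {c} → sum w ⊑ c → 3 · a ⊑ c → ∀ M x → start M x ⊕ w x ⊑ a ⊕ c
      start-end≤ {c} load≤c 3a≤c = bound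
        where
        r≤c : r ⊑ c
        r≤c = ⊑-trans (+-monoˡ-≤ (sum (tail w)) (w≥0 zero)) load≤c

        2a≤c : a ⊕ a ⊑ c
        2a≤c = ⊑-trans (+-monoʳ-≤ a (x≤x+y (sum≥0 {1} (λ _ → a) (λ _ → w≥0 zero)))) 3a≤c

        c≤a+c : c ⊑ a ⊕ c
        c≤a+c = ⊑-respʳ-≡ (comm c a) (x≤x+y (w≥0 zero))

        bound : ∀ M x → start M x ⊕ w x ⊑ a ⊕ c
        bound M₁ zero    = ⊑-respˡ-≡ (comm a _) (+-monoʳ-≤ a (⊔-elim (_⊑ c) r≤c 2a≤c))
        bound M₁ (suc x) = ⊑-trans (⊑-trans (starts-end 0# (tail w) (w≥0 ∘ suc) x) r≤c) c≤a+c
        bound M₂ x       = ⊑-trans (starts-end 0# w w≥0 x) (+-mono-≤ (w≥0 zero) load≤c)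
        bound M₃ x       = ⊑-trans (starts-end a w w≥0 x) (+-monoʳ-≤ a load≤c)

      schedule-ratio : ∀ c → IsMinimumMakespan I c → 3 · makespan I schedule ⊑ 4 · c
      -- The witness `S` is an optimal schedule, to which both lower bounds are applied.
      schedule-ratio _ ((S , feasible , refl) , _) = begin
        3 · makespan I schedule  ≤⟨ ·-monoʳ-≤ 3 (makespan≤ schedule 0≤a+c end≤a+c) ⟩
        3 · (a ⊕ c)              ≡⟨ ×-distrib-+ a c 3 ⟩
        -- `4 · c` unfolds to `c ⊕ 3 · c`, so it suffices to bound `3 · a` by `c`.
        3 · a ⊕ 3 · c            ≤⟨ +-monoˡ-≤ (3 · c) 3a≤c ⟩
        4 · c                    ∎
        where
        c = makespan I S

        3a≤c : 3 · a ⊑ c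
        3a≤c = subst (λ d → 3 · d ⊑ c) (sym (w≡ zero)) (3·processingTime≤makespan S feasible (to zero))

        0≤a+c : 0# ⊑ a ⊕ c
        0≤a+c = ⊑-trans (w≥0 zero) (x≤x+y (⊥≤max 0# (map (completion I S) (jobs ℓ k))))

        end≤a+c : ∀ j M → end I schedule j M ⊑ a ⊕ c
        end≤a+c j M = subst (λ d → schedule j M ⊕ d ⊑ a ⊕ c) (sym (processingTime≡w j))
          (start-end≤ (load≤makespan S feasible position w w≡) 3a≤c M (from j))

      schedule-approximates : Approximates schedule
      schedule-approximates = schedule-feasible , schedule-ratio

  -- Correctness and linear running time.

  -- The cost is one subtraction for the origin, `m` additions for `M₁`, `suc m` for each of `M₂`
  -- and `M₃`, and the addition and comparison of `combine`.
  timetable-↠ : ∀ {ℓ k} (p : Vector Carrier ℓ) (q : Vector Carrier (suc k)) o →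
    let m = k ℕ+ ℓ in
    timetable p q o ↠[ 1 ℕ+ (m ℕ+ (suc m ℕ+ (suc m ℕ+ 2))) ]
    return λ j M → machineStarts 0# (lengths p q o) M (Inverse.from (layout o) j)
  timetable-↠ p q o =
    subst (λ t → timetable p q o ↠[ _ ] return λ j M → machineStarts t w M (Inverse.from (layout o) j))
      (+-inverseʳ (head w))
      (↠-trans {c = 1} (refl , refl)
      (↠-trans (prefixSums-↠ t (tail w) _)
      (↠-trans (prefixSums-↠ t w λ s₂ _ → prefixSums (head w) w λ s₃ _ → combine p q o s₁ load s₂ s₃)
      (↠-trans (prefixSums-↠ (head w) w λ s₃ _ → combine p q o s₁ load (starts t w) s₃)
      (refl , refl)))))
    where
    w = lengths p q o
    t = head w ⊕ (- head w)
    s₁ = starts t (tail w)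
    load = t ⊕ sum (tail w)

  -- The leading `k` counts the comparisons of `argmax`. The slack k + 2ℓ, added on the left, leaves
  -- an identity for the solver.
  timetable-cost : ∀ k ℓ → k ℕ+ (1 ℕ+ (k ℕ+ ℓ ℕ+ (suc (k ℕ+ ℓ) ℕ+ (suc (k ℕ+ ℓ) ℕ+ 2)))) ℕ+ 0
                           ≤ 5 * (ℓ ℕ+ suc k)
  timetable-cost k ℓ = ℕ.m+n≤o⇒m≤o _ (ℕ.≤-reflexive (solve 2 (λ k ℓ →
    k :+ (con 1 :+ (k :+ ℓ :+ ((con 1 :+ (k :+ ℓ)) :+ ((con 1 :+ (k :+ ℓ)) :+ con 2)))) :+ con 0
      :+ (k :+ con 2 :* ℓ) := con 5 :* (ℓ :+ (con 1 :+ k))) refl k ℓ))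
    where open +-*-Solver

  lengths≤ : ∀ {ℓ k} (p : Vector Carrier ℓ) (q : Vector Carrier (suc k)) o →
             (∀ i → p i ⊑ q o) → (∀ o′ → q o′ ⊑ q o) → ∀ x → lengths p q o x ⊑ q o
  lengths≤ p q o p≤ q≤ x with Inverse.to (layout o) x
  ... | flow i       = p≤ i
  ... | open-shop o′ = q≤ o′

  processingTime≡[p,q] : ∀ (I : Instance K) j →
                         [ Instance.p I , Instance.q I ] j ≡ Instance.processingTime I j
  processingTime≡[p,q] I (flow i)      = refl
  processingTime≡[p,q] I (open-shop o) = refl

  timetable-correct : ∀ {ℓ k 1≤ℓ 1≤k} {p : Vector Carrier ℓ} {q : Vector Carrier (suc k)} {p>0 q>0} →
    let I : Instance K
        I = record { 1≤ℓ = 1≤ℓ ; 1≤k = 1≤k ; p = p ; q = q ; p>0 = p>0 ; q>0 = q>0 } in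
    ∀ o → (∀ i → p i ⊑ q o) → (∀ o′ → q o′ ⊑ q o) → algorithm p q ↠[ k ] timetable p q o →
    runningTime algorithm I ≤ 5 * (ℓ ℕ+ suc k) × Approximates I (output algorithm I)
  timetable-correct {ℓ} {k} {p = p} {q} o p≤ q≤ run =
    ℕ.≤-trans (ℕ.≤-reflexive steps≡) (timetable-cost k ℓ) ,
    subst (Approximates _) (sym result≡)
      (schedule-approximates _ (layout o) (lengths p q o)
        -- `refl` suffices since `layout o` sends position zero to `open-shop o` by computation.
        (processingTime≡[p,q] _ ∘ Inverse.to (layout o)) o refl (lengths≤ p q o p≤ q≤))
    where
    open _↠[_]_ (↠-trans run (timetable-↠ p q o))

  algorithm-correct : ∀ (I : Instance K) → LargestJobIsOpenShop I →
                      runningTime algorithm I ≤ 5 * Instance.n I × Approximates I (output algorithm I)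
  algorithm-correct record { k = suc k ; p = p ; q = q } (i₁ , o₁ , p≤ , q≤ , p<q) =
    let o , q≤qₒ , run = argmax-↠ q (timetable p q) in
    -- The job `o` found may differ from `o₁`, but is at least as long, so it also dominates every
    -- flow-shop job.
    timetable-correct o (λ i → ⊑-trans (p≤ i) (⊑-trans (proj₁ p<q) (q≤qₒ o₁))) q≤qₒ run

-- From linear time to n log n.

1≤⌈log₂n⌉ : ∀ {n} → 2 ≤ n → 1 ≤ ⌈log₂ n ⌉
1≤⌈log₂n⌉ {n} 2≤n = subst (_≤ ⌈log₂ n ⌉) (⌈log₂2^n⌉≡n 1) (⌈log₂⌉-mono-≤ 2≤n)

-- An instance has a job of each kind, so n is at least 2 and the logarithm is at least 1.
n≤n*⌈log₂n⌉ : ∀ {n} → 2 ≤ n → n ≤ n * ⌈log₂ n ⌉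
n≤n*⌈log₂n⌉ {n} 2≤n = ℕ.m≤m*n n ⌈log₂ n ⌉ {{>-nonZero (1≤⌈log₂n⌉ 2≤n)}}

theorem4p1 : Σ[ A ∈ Algorithm ] Σ[ c ∈ ℕ ]
    ((K : OrderedGroup) (I : Instance K) → LargestJobIsOpenShop I →
    runningTime A I ≤ c * (Instance.n I * ⌈log₂ Instance.n I ⌉) ×
    FourThirdsApproximate A I)
theorem4p1 = algorithm , 5 , λ K I large →
  ℕ.≤-trans (proj₁ (algorithm-correct K I large))
    (ℕ.*-monoʳ-≤ 5 (n≤n*⌈log₂n⌉ (ℕ.+-mono-≤ (Instance.1≤ℓ I) (Instance.1≤k I)))) ,
  approximates⇒fourThirds K I algorithm (proj₂ (algorithm-correct K I large))
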